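{- Let $n,k,s,p$ be positive integers with $n\geq (s+1)k$, and let $\vec{p}=(p_0,p_1,\ldots,p_s)=(p,1,\ldots,1)$ (so $p_0=p$ and $p_1=\cdots=p_s=1$). Then $$f_{\vec{p}}(n,k,s)\leq \max\left\{s\binom{n}{k},\ (p+s)s\binom{n-1}{k-1}\right\}.$$
   Context: $[n]=\{1,\ldots,n\}$ and $\binom{[n]}{k}$ is the collection of all $k$-element subsets of $[n]$. For families $\mathcal{A}_1,\ldots,\mathcal{A}_m\subseteq 2^{[n]}$ the rainbow matching number $\nu(\mathcal{A}_1,\ldots,\mathcal{A}_m)$ is the maximum integer $r$ such that there are indices $1\leq i_1<\cdots<i_r\leq m$ and pairwise disjoint sets $A_{i_1}\in\mathcal{A}_{i_1},\ldots,A_{i_r}\in\mathcal{A}_{i_r}$. A sequence of $s+1$ families $\mathcal{B}_0,\mathcal{B}_1,\ldots,\mathcal{B}_s\subseteq 2^{[n]}$ is called overlapping if $\nu(\mathcal{B}_0,\ldots,\mathcal{B}_s)\leq s$, i.e. one cannot choose pairwise disjoint sets $B_i\in\mathcal{B}_i$, $i=0,\ldots,s$. For real constants $p_0\geq p_1\geq\cdots\geq p_s>0$, $\vec{p}=(p_0,\ldots,p_s)$ and $n\geq (s+1)k$, define $$f_{\vec{p}}(n,k,s)=\max\left\{\sum_{i=0}^s p_i|\mathcal{B}_i| : \mathcal{B}_0\subseteq\mathcal{B}_1\subseteq\cdots\subseteq\mathcal{B}_s\subseteq\binom{[n]}{k}\text{ are overlapping}\right\}$$ (families may be empty and may coincide).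 -}

module Defs where

open import Algebra.Properties.CommutativeMonoid.Sum using (sum)
open import Data.Bool using (Bool; true; false; T; T?)
open import Data.Empty using (⊥-elim)
open import Data.Fin using (Fin; zero; suc; inject₁; _≟_)
open import Data.Fin.Properties using (all?)
open import Data.Fin.Subset using (Subset; inside; outside; _∈_; _∩_; ⊥; ∣_∣; Empty)
open import Data.Fin.Subset.Properties
  using (_∈?_; nonempty?; anySubset?; ∉⊥; ∣⊥∣≡0; ∣p∣≤n; Empty-unique)
open import Data.List using (List; length; map; filterᵇ)
import Data.List as List
open import Data.List.Properties using (length-filter; filter-≐)
open import Data.Nat using (ℕ; zero; suc; _+_; _*_; _≤_; z≤n)
import Data.Nat as ℕ
open import Data.Nat.Properties
  using (+-0-commutativeMonoid; ≤-trans; ≤-pred;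
         ≤∧≢⇒<; +-mono-≤; *-monoʳ-≤; _≤?_)
open import Data.Product using (∃; ∃₂; _×_; _,_; proj₁; proj₂)
import Data.Vec as Vec
open import Data.Vec.Functional using (Vector; []; _∷_; head; tail)
open import Function using (_∘_; const)
open import Relation.Binary.PropositionalEquality
  using (_≡_; _≢_; _≗_; refl; sym; trans; cong; cong₂; subst)
open import Relation.Nullary using (Dec; yes; no)
open import Relation.Nullary.Decidable using (map′; decidable-stable; ¬?; _×-dec_; _→-dec_; _⊎-dec_)
open import Data.Sum using (_⊎_; inj₁; inj₂; [_,_])
open import Relation.Unary using (Decidable)

private
  variable
    m n s : ℕ

∑ : Vector ℕ m → ℕ
∑ = sum +-0-commutativeMonoid

-- A family of subsets of [n], given by its indicator function.
Family : ℕ → Set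
Family n = Subset n → Bool

infix 4 _∈ᶠ_ _⊆ᶠ_

_∈ᶠ_ : Subset n → Family n → Set
A ∈ᶠ ℬ = T (ℬ A)

_⊆ᶠ_ : Family n → Family n → Set
ℬ ⊆ᶠ 𝒞 = ∀ A → A ∈ᶠ ℬ → A ∈ᶠ 𝒞

-- ℬ ⊆ binom([n], k)
Uniform : ℕ → Family n → Set
Uniform k ℬ = ∀ A → A ∈ᶠ ℬ → ∣ A ∣ ≡ k

-- Every subset of [n], listed exactly once.
subsets : ∀ n → List (Subset n)
subsets zero    = Vec.[] List.∷ List.[]
subsets (suc n) = map (outside Vec.∷_) (subsets n) List.++ map (inside Vec.∷_) (subsets n)

card : Family n → ℕ
card ℬ = length (filterᵇ ℬ (subsets _))

IsMaximum : (ℕ → Set) → ℕ → Set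
IsMaximum P v = P v × (∀ w → P w → w ≤ v)

-- The indices i₁ < ⋯ < iᵣ are given as the r-element set I of them; the
-- values of A outside I are irrelevant.
RainbowMatching : Vector (Family n) m → ℕ → Set
RainbowMatching {n} {m} ℬ r =
  ∃₂ λ (I : Subset m) (A : Vector (Subset n) m) →
    ∣ I ∣ ≡ r ×
    (∀ i → i ∈ I → A i ∈ᶠ ℬ i) ×
    (∀ i j → i ∈ I → j ∈ I → i ≢ j → Empty (A i ∩ A j))

private

  maximum : ∀ {P : ℕ → Set} → Decidable P → ∀ b → (∀ w → P w → w ≤ b) → ∃ P → ∃ (IsMaximum P)
  maximum P? b bound (v , pv) with P? b
  ... | yes pb = b , pb , bound
  maximum P? zero bound (v , pv) | no ¬pb with bound v pv
  ... | z≤n = ⊥-elim (¬pb pv)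
  maximum {P} P? (suc b) bound e | no ¬pb = maximum P? b bound′ e
    where
    bound′ : ∀ w → P w → w ≤ b
    bound′ w pw = ≤-pred (≤∧≢⇒< (bound w pw) λ eq → ¬pb (subst P eq pw))

  maximum-unique-≤ : ∀ {P Q : ℕ → Set} {v w} → (∀ {u} → P u → Q u) →
                     IsMaximum P v → IsMaximum Q w → v ≤ w
  maximum-unique-≤ P⇒Q (pv , _) (_ , maxQ) = maxQ _ (P⇒Q pv)

  Search : (A : Set) → (A → A → Set) → Set₁
  Search A _≈_ = ∀ {P : A → Set} → (∀ {x y} → x ≈ y → P x → P y) → Decidable P → Dec (∃ P)

  searchVector : ∀ {A : Set} {_≈_ : A → A → Set} → (∀ {x} → x ≈ x) → Search A _≈_ →
                 ∀ m → Search (Vector A m) (λ f g → ∀ i → f i ≈ g i)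
  searchVector ≈-refl search zero resp P? =
    map′ ([] ,_) (λ (_ , p) → resp (λ ()) p) (P? [])
  searchVector {_≈_ = _≈_} ≈-refl search (suc m) resp P? =
    map′ (λ (x , xs , p) → x ∷ xs , p)
         (λ (f , p) → head f , tail f , resp (λ { zero → ≈-refl ; (suc i) → ≈-refl }) p)
         (search (λ x≈y (xs , p) → xs , resp (λ { zero → x≈y ; (suc i) → ≈-refl }) p)
           λ x → searchVector {_≈_ = _≈_} ≈-refl search m
             (λ xs≈ys → resp λ { zero → ≈-refl ; (suc i) → xs≈ys i })
             (λ xs → P? (x ∷ xs)))

  join : Family n → Family n → Family (suc n)
  join 𝒞 𝒟 (outside Vec.∷ A) = 𝒞 A
  join 𝒞 𝒟 (inside Vec.∷ A)  = 𝒟 A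

  searchFamily : ∀ n → Search (Family n) _≗_
  searchFamily zero {P} resp P? =
    map′ [ (λ p → const true , p) , (λ p → const false , p) ]
         (λ (ℬ , p) → split ℬ p (ℬ Vec.[]) refl)
         (P? (const true) ⊎-dec P? (const false))
    where
    split : ∀ ℬ → P ℬ → ∀ b → ℬ Vec.[] ≡ b → P (const true) ⊎ P (const false)
    split ℬ p true  eq = inj₁ (resp (λ { Vec.[] → eq }) p)
    split ℬ p false eq = inj₂ (resp (λ { Vec.[] → eq }) p)
  searchFamily (suc n) resp P? =
    map′ (λ (𝒞 , 𝒟 , p) → join 𝒞 𝒟 , p)
         (λ (ℬ , p) → ℬ ∘ (outside Vec.∷_) , ℬ ∘ (inside Vec.∷_) ,
           resp (λ { (outside Vec.∷ A) → refl ; (inside Vec.∷ A) → refl }) p)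
         (searchFamily n
           (λ eq (𝒟 , p) → 𝒟 , resp (λ { (outside Vec.∷ A) → eq A ; (inside Vec.∷ A) → refl }) p)
           λ 𝒞 → searchFamily n
             (λ eq → resp λ { (outside Vec.∷ A) → refl ; (inside Vec.∷ A) → eq A })
             (λ 𝒟 → P? (join 𝒞 𝒟)))

  allSubset? : ∀ {P : Subset n → Set} → Decidable P → Dec (∀ A → P A)
  allSubset? P? = map′ (λ ¬∃ A → decidable-stable (P? A) λ ¬p → ¬∃ (A , ¬p))
                       (λ ∀p (A , ¬p) → ¬p (∀p A))
                       (¬? (anySubset? (¬? ∘ P?)))

  rainbowMatching? : (ℬ : Vector (Family n) m) → Decidable (RainbowMatching ℬ)
  rainbowMatching? {n} {m} ℬ r = anySubset? λ I →
    searchVector {_≈_ = _≡_} refl (λ _ → anySubset?) m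
      (λ A≡A′ (c , mem , disj) →
        c ,
        (λ i i∈I → subst (_∈ᶠ ℬ i) (A≡A′ i) (mem i i∈I)) ,
        (λ i j i∈I j∈I i≢j → subst Empty (cong₂ _∩_ (A≡A′ i) (A≡A′ j)) (disj i j i∈I j∈I i≢j)))
      λ A →
        (∣ I ∣ ℕ.≟ r) ×-dec
        all? (λ i → (i ∈? I) →-dec T? (ℬ i (A i))) ×-dec
        all? (λ i → all? λ j →
          (i ∈? I) →-dec ((j ∈? I) →-dec (¬? (i ≟ j) →-dec ¬? (nonempty? (A i ∩ A j)))))

  ν-exists : (ℬ : Vector (Family n) m) → ∃ (IsMaximum (RainbowMatching ℬ))
  ν-exists {m = m} ℬ = maximum (rainbowMatching? ℬ) m
    (λ { _ (I , _ , refl , _) → ∣p∣≤n I })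
    (0 , ⊥ , const ⊥ , ∣⊥∣≡0 m , (λ _ → ⊥-elim ∘ ∉⊥) , (λ _ _ → ⊥-elim ∘ ∉⊥))

ν : Vector (Family n) m → ℕ
ν ℬ = proj₁ (ν-exists ℬ)

ν-isMaximum : (ℬ : Vector (Family n) m) → IsMaximum (RainbowMatching ℬ) (ν ℬ)
ν-isMaximum ℬ = proj₂ (ν-exists ℬ)

Overlapping : Vector (Family n) (suc s) → Set
Overlapping {s = s} ℬ = ν ℬ ≤ s

weight : Vector ℕ m → Vector (Family n) m → ℕ
weight p ℬ = ∑ (λ i → p i * card (ℬ i))

Admissible : (n k s : ℕ) → Vector (Family n) (suc s) → Set
Admissible n k s ℬ =
  (∀ (i : Fin s) → ℬ (inject₁ i) ⊆ᶠ ℬ (suc i)) × (∀ i → Uniform k (ℬ i)) × Overlapping ℬ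

Attained : Vector ℕ (suc s) → (n k : ℕ) → ℕ → Set
Attained {s} p n k v = ∃ λ ℬ → Admissible n k s ℬ × weight p ℬ ≡ v

private

  ⊆ᶠ-resp : {ℬ ℬ′ 𝒞 𝒞′ : Family n} → ℬ ≗ ℬ′ → 𝒞 ≗ 𝒞′ → ℬ ⊆ᶠ 𝒞 → ℬ′ ⊆ᶠ 𝒞′
  ⊆ᶠ-resp eq eq′ sub A = subst T (eq′ A) ∘ sub A ∘ subst T (sym (eq A))

  ν-resp : {ℬ 𝒞 : Vector (Family n) m} → (∀ i → ℬ i ≗ 𝒞 i) → ν 𝒞 ≤ ν ℬ
  ν-resp {ℬ = ℬ} {𝒞} eq = maximum-unique-≤
    (λ (I , A , c , mem , disj) → I , A , c , (λ i → subst T (sym (eq i (A i))) ∘ mem i) , disj)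
    (ν-isMaximum 𝒞) (ν-isMaximum ℬ)

  card-resp : {ℬ 𝒞 : Family n} → ℬ ≗ 𝒞 → card ℬ ≡ card 𝒞
  card-resp {n} {ℬ} {𝒞} eq = cong length
    (filter-≐ (T? ∘ ℬ) (T? ∘ 𝒞)
      ((λ {A} → subst T (eq A)) , (λ {A} → subst T (sym (eq A)))) (subsets n))

  ∑-cong : {f g : Vector ℕ m} → (∀ i → f i ≡ g i) → ∑ f ≡ ∑ g
  ∑-cong {zero}  eq = refl
  ∑-cong {suc m} eq = cong₂ _+_ (eq zero) (∑-cong (eq ∘ suc))

  ∑-mono : {f g : Vector ℕ m} → (∀ i → f i ≤ g i) → ∑ f ≤ ∑ g
  ∑-mono {zero}  le = z≤n
  ∑-mono {suc m} le = +-mono-≤ (le zero) (∑-mono (le ∘ suc))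

  attained? : (p : Vector ℕ (suc s)) → ∀ n k → Decidable (Attained p n k)
  attained? {s} p n k v = searchVector {_≈_ = _≗_} (λ _ → refl) (searchFamily n) (suc s)
    (λ eq ((chain , unif , over) , w) →
      ( (λ i → ⊆ᶠ-resp (eq (inject₁ i)) (eq (suc i)) (chain i))
      , (λ i A → unif i A ∘ subst T (sym (eq i A)))
      , ≤-trans (ν-resp eq) over)
      , trans (∑-cong λ i → cong (p i *_) (card-resp (sym ∘ eq i))) w)
    λ ℬ →
      (all? (λ i → allSubset? λ A → T? (ℬ (inject₁ i) A) →-dec T? (ℬ (suc i) A))
        ×-dec all? (λ i → allSubset? λ A → T? (ℬ i A) →-dec (∣ A ∣ ℕ.≟ k))
        ×-dec (ν ℬ ≤? s))
      ×-dec (weight p ℬ ℕ.≟ v)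

  overlapping-empty : ∀ n s → Overlapping {n} {s} (λ _ _ → false)
  overlapping-empty n s with ν {n} {suc s} (λ _ _ → false) | ν-isMaximum {n} {suc s} (λ _ _ → false)
  ... | _ | (I , A , refl , mem , _) , _
    rewrite Empty-unique {p = I} (λ (i , i∈I) → mem i i∈I) | ∣⊥∣≡0 (suc s) = z≤n

  f-exists : (p : Vector ℕ (suc s)) → ∀ n k → ∃ (IsMaximum (Attained p n k))
  f-exists {s} p n k = maximum (attained? p n k) (∑ λ i → p i * length (subsets n))
    (λ { _ (ℬ , _ , refl) → ∑-mono λ i → *-monoʳ-≤ (p i) (length-filter (T? ∘ ℬ i) (subsets n)) })
    (_ , (λ _ _ → false) , ((λ _ _ ()) , (λ _ _ ()) , overlapping-empty n s) , refl)

-- f p n k is f_p(n, k, s), where s is determined by p = (p₀, …, pₛ).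
f : Vector ℕ (suc s) → (n k : ℕ) → ℕ
f p n k = proj₁ (f-exists p n k)

f-isMaximum : (p : Vector ℕ (suc s)) → ∀ n k → IsMaximum (Attained p n k) (f p n k)
f-isMaximum p n k = proj₂ (f-exists p n k)

{-# OPTIONS --safe #-}
module Submission where

-- Katona's circle method. For a cyclic ordering of [n], let S_i ⊆ ℤ/n be the set
-- of starting points of those arcs of length k that lie in ℬ_i. The S_i form a
-- chain without pairwise disjoint arcs starting in S_0, …, S_s, and for such a
-- chain
--     (n/k − s)|S_0| + |S_1| + ⋯ + |S_s| ≤ s n.
-- This holds for n = (s+1)k, since in a residue class mod k, which consists of
-- s+1 pairwise disjoint arcs, some S_i has at most i elements. For larger n take
-- the last S_j ≠ ℤ/n and delete a point outside it: the right-hand side drops by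
-- s, and the left-hand side by at most |S_0|/k + (s − j), where |S_0| ≤ jk
-- because otherwise S_0 would supply the first j+1 of the s+1 disjoint arcs.
-- Averaging over all orderings, (n/k − s)|ℬ_0| + |ℬ_1| + ⋯ + |ℬ_s| ≤ s C(n,k),
-- and |ℬ_0| ≤ s C(n−1,k−1) as ℬ_0 is the smallest family. These give the first
-- bound if p ≤ n/k − s and the second one otherwise.

open import Defs
open import Algebra.Properties.CommutativeMonoid.Sum using (sum-remove; ∑-distrib-+; ∑-comm; sum-cong-≗)
open import Algebra.Properties.Semiring.Sum using (*-distribˡ-sum)
open import Data.Bool using (Bool; true; false; T; T?; _∧_; _∨_; not)
import Data.Bool as Bool
open import Data.Empty using (⊥-elim)
open import Data.Fin using (Fin; zero; suc; toℕ; inject₁; punchIn; combine; remQuot; _↑ˡ_; _↑ʳ_)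
import Data.Fin as Fin
open import Data.Fin.Properties
  using (punchIn-injective; punchInᵢ≢i; toℕ-combine; toℕ<n; remQuot-combine; toℕ-injective; all?; ¬∀⟶∃¬)
open import Data.Fin.Subset using (Subset; inside; outside; _∈_; _∩_; ⊥; ⊤; ∣_∣; Empty)
open import Data.Fin.Subset.Properties using (∉⊥; Empty-unique; x∈p∩q⁻; ∣⊤∣≡n)
import Data.List as List
open import Data.List.Properties using (length-++; filter-++)
open import Data.Nat
  using (ℕ; _+_; _*_; _∸_; _≤_; _⊔_; NonZero; zero; suc; _<_; ≢-nonZero; >-nonZero; >-nonZero⁻¹; z≤n; s≤s; _≤?_; _<?_; _!;
         ∣_-_∣; _⊓_)
import Data.Nat as Nat
open import Data.Nat.Combinatorics using (_C_; nCk≡n!/k![n-k]!; k![n∸k]!∣n!)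
open import Data.Nat.DivMod using (m/n*n≡m)
open import Data.Nat.Properties
open import Data.Nat.Tactic.RingSolver using (solve-∀)
open import Data.Product using (∃; _×_; _,_; proj₁; proj₂)
open import Data.Sum using (_⊎_; inj₁; inj₂)
open import Data.Unit using (tt)
open import Data.Vec using (insertAt; tabulate)
import Data.Vec as Vec
open import Data.Vec.Functional using (Vector; _∷_; replicate)
open import Data.Vec.Properties using ([]=⇒lookup; lookup∘tabulate)
open import Function using (_∘_)
open import Relation.Binary.PropositionalEquality
open import Relation.Nullary using (¬_; Dec; yes; no; contradiction)

private
  variable
    m n s : ℕ

-- Indicators and finite sums.

⟦_⟧ : Bool → ℕ
⟦ true ⟧  = 1
⟦ false ⟧ = 0

⟦⟧≤1 : ∀ b → ⟦ b ⟧ ≤ 1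
⟦⟧≤1 true  = ≤-refl
⟦⟧≤1 false = z≤n

⟦⟧-true : ∀ {b} → T b → ⟦ b ⟧ ≡ 1
⟦⟧-true {true} _ = refl

⟦⟧-false : ∀ {b} → ¬ T b → ⟦ b ⟧ ≡ 0
⟦⟧-false {true}  ¬t = ⊥-elim (¬t tt)
⟦⟧-false {false} _  = refl

⟦⟧-mono : ∀ {b c} → (T b → T c) → ⟦ b ⟧ ≤ ⟦ c ⟧
⟦⟧-mono {false} _ = z≤n
⟦⟧-mono {true} {true} _ = ≤-refl
⟦⟧-mono {true} {false} imp = ⊥-elim (imp tt)

# : (Fin n → Bool) → ℕ
# S = ∑ λ x → ⟦ S x ⟧

∑-cong : {f g : Vector ℕ m} → (∀ i → f i ≡ g i) → ∑ f ≡ ∑ g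
∑-cong = sum-cong-≗ +-0-commutativeMonoid

∑-+ : (f g : Vector ℕ m) → ∑ (λ i → f i + g i) ≡ ∑ f + ∑ g
∑-+ = ∑-distrib-+ +-0-commutativeMonoid

∑-swap : (f : Fin m → Fin n → ℕ) → ∑ (λ i → ∑ (f i)) ≡ ∑ (λ j → ∑ (λ i → f i j))
∑-swap = ∑-comm +-0-commutativeMonoid

∑-punchIn : ∀ i (f : Vector ℕ (suc n)) → ∑ f ≡ f i + ∑ (f ∘ punchIn i)
∑-punchIn i f = sum-remove +-0-commutativeMonoid {i = i} f

∑-*ˡ : ∀ c (f : Vector ℕ m) → ∑ (λ i → c * f i) ≡ c * ∑ f
∑-*ˡ c f = sym (*-distribˡ-sum +-*-semiring c f)

∑-mono : {f g : Vector ℕ m} → (∀ i → f i ≤ g i) → ∑ f ≤ ∑ g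
∑-mono {zero}  le = z≤n
∑-mono {suc m} le = +-mono-≤ (le zero) (∑-mono (le ∘ suc))

∑-const : ∀ m c → ∑ {m} (λ _ → c) ≡ m * c
∑-const zero    c = refl
∑-const (suc m) c = cong (c +_) (∑-const m c)

∑-≤ : ∀ {c} {f : Vector ℕ m} → (∀ i → f i ≤ c) → ∑ f ≤ m * c
∑-≤ {m} {c} le = ≤-trans (∑-mono le) (≤-reflexive (∑-const m c))

∑-↑ : ∀ m (f : Vector ℕ (m + n)) → ∑ f ≡ ∑ (λ i → f (i ↑ˡ n)) + ∑ (λ j → f (m ↑ʳ j))
∑-↑ zero    f = refl
∑-↑ (suc m) f = trans (cong (f zero +_) (∑-↑ m (f ∘ suc))) (sym (+-assoc (f zero) _ _))

∑-combine : ∀ m (f : Vector ℕ (m * n)) → ∑ f ≡ ∑ λ i → ∑ λ j → f (combine {m} i j)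
∑-combine zero        f = refl
∑-combine {n} (suc m) f =
  trans (∑-↑ n f) (cong (∑ (λ j → f (j ↑ˡ (m * n))) +_) (∑-combine m (f ∘ (n ↑ʳ_))))

-- Pigeonhole, distinct representatives and monotone sums.

pigeonhole : ∀ c (f : Vector ℕ m) → m * c < ∑ f → ∃ λ i → c < f i
pigeonhole {m} c f lt with all? (λ i → f i ≤? c)
... | yes le = contradiction (∑-≤ le) (<⇒≱ lt)
... | no ¬le with i , fi≰c ← ¬∀⟶∃¬ m _ (λ i → f i ≤? c) ¬le = i , ≰⇒> fi≰c

#-full : {S : Fin n → Bool} → (∀ x → T (S x)) → # S ≡ n
#-full {n} full = trans (∑-cong (⟦⟧-true ∘ full)) (trans (∑-const n 1) (*-identityʳ n))

#-mono : (S S′ : Fin n → Bool) → (∀ x → T (S x) → T (S′ x)) → # S ≤ # S′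
#-mono S S′ S⊆S′ = ∑-mono λ x → ⟦⟧-mono (S⊆S′ x)

-- Greedy choice: deleting the point picked for `S zero` costs every later set at most one element,
-- and the index of that set drops by one as well.
distinct-representatives : (S : Fin m → Fin n → Bool) → (∀ i → toℕ i < # (S i)) →
  ∃ λ (x : Fin m → Fin n) → (∀ i → T (S i (x i))) × (∀ i j → i ≢ j → x i ≢ x j)
distinct-representatives {zero} S big = (λ ()) , (λ ()) , λ ()
distinct-representatives {suc m} {zero} S big = contradiction (big zero) λ ()
distinct-representatives {suc m} {suc n} S big = x , x∈S , x-distinct
  where
  first : ∃ λ y → T (S zero y)
  first with y , 0<Sy ← pigeonhole 0 (λ y → ⟦ S zero y ⟧) (subst (_< # (S zero)) (sym (*-zeroʳ n)) (big zero))
        with S zero y in eq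
  ... | true = y , subst T (sym eq) tt

  y = proj₁ first

  big′ : ∀ i → toℕ i < # (S (suc i) ∘ punchIn y)
  big′ i = +-cancelˡ-≤ 1 _ _ (begin
    suc (suc (toℕ i))                                 ≤⟨ big (suc i) ⟩
    # (S (suc i))                                     ≡⟨ ∑-punchIn y (λ z → ⟦ S (suc i) z ⟧) ⟩
    ⟦ S (suc i) y ⟧ + # (S (suc i) ∘ punchIn y)       ≤⟨ +-monoˡ-≤ _ (⟦⟧≤1 (S (suc i) y)) ⟩
    1 + # (S (suc i) ∘ punchIn y)                     ∎)
    where open ≤-Reasoning

  rest = distinct-representatives (λ i → S (suc i) ∘ punchIn y) big′

  x : Fin (suc m) → Fin (suc n)
  x zero    = y
  x (suc i) = punchIn y (proj₁ rest i)

  x∈S : ∀ i → T (S i (x i))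
  x∈S zero    = proj₂ first
  x∈S (suc i) = proj₁ (proj₂ rest) i

  x-distinct : ∀ i j → i ≢ j → x i ≢ x j
  x-distinct zero    zero    i≢j = contradiction refl i≢j
  x-distinct zero    (suc j) i≢j = punchInᵢ≢i y _ ∘ sym
  x-distinct (suc i) zero    i≢j = punchInᵢ≢i y _
  x-distinct (suc i) (suc j) i≢j = proj₂ (proj₂ rest) i j (i≢j ∘ cong suc) ∘ punchIn-injective y _ _

-- By monotonicity the entries up to index i are at most c, while the others are
-- at most c + e.
∑-monotone-≤ : ∀ {c e} (b : Vector ℕ m) → (∀ i j → i Fin.≤ j → b i ≤ b j) → (∀ j → b j ≤ c + e) →
  ∀ i → b i ≤ c → ∑ b + suc (toℕ i) * e ≤ m * (c + e)
∑-monotone-≤ {suc m} {c} {e} b mono b≤ zero b₀≤c = begin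
  b zero + ∑ (b ∘ suc) + (e + 0)   ≡⟨ rearrange (b zero) _ e ⟩
  (b zero + e) + ∑ (b ∘ suc)       ≤⟨ +-mono-≤ (+-monoˡ-≤ e b₀≤c) (∑-≤ (b≤ ∘ suc)) ⟩
  (c + e) + m * (c + e)            ∎
  where
  open ≤-Reasoning
  rearrange : ∀ x y z → x + y + (z + 0) ≡ (x + z) + y
  rearrange = solve-∀
∑-monotone-≤ {suc m} {c} {e} b mono b≤ (suc i) bᵢ≤c = begin
  b zero + ∑ (b ∘ suc) + (e + suc (toℕ i) * e)     ≡⟨ rearrange (b zero) _ e _ ⟩
  (b zero + e) + (∑ (b ∘ suc) + suc (toℕ i) * e)   ≤⟨ +-mono-≤ (+-monoˡ-≤ e (≤-trans (mono zero (suc i) z≤n) bᵢ≤c))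
                                                        (∑-monotone-≤ (b ∘ suc) (λ j l j≤l → mono _ _ (s≤s j≤l)) (b≤ ∘ suc) i bᵢ≤c) ⟩
  (c + e) + m * (c + e)                            ∎
  where
  open ≤-Reasoning
  rearrange : ∀ x y z w → x + y + (z + w) ≡ (x + z) + (y + w)
  rearrange = solve-∀

-- In `cyclic-bound` this finds the last set of the chain that misses a point of the cycle, so that
-- all later sets are the whole cycle.
last-failure : {P : Fin m → Set} → (∀ i → Dec (P i)) →
  (∀ i → P i) ⊎ ∃ λ j → ¬ P j × (∀ i → j Fin.< i → P i)
last-failure {zero}  P? = inj₁ λ ()
last-failure {suc m} P? with last-failure (P? ∘ suc)
... | inj₂ (j , ¬pj , after) = inj₂ (suc j , ¬pj , λ { (suc i) (s≤s j<i) → after i j<i })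
... | inj₁ all with P? zero
...   | yes p0 = inj₁ λ { zero → p0 ; (suc i) → all i }
...   | no ¬p0 = inj₂ (zero , ¬p0 , λ { (suc i) _ → all i })

-- Disjoint arcs on a cycle and deletion of a point.

-- The points x and y of the cycle ℤ/n start disjoint arcs of length k.
Far : ℕ → Fin n → Fin n → Set
Far {n} k x y = k ≤ ∣ toℕ x - toℕ y ∣ × k + ∣ toℕ x - toℕ y ∣ ≤ n

Separated : ℕ → Vector (Fin n) m → Set
Separated k x = ∀ i j → i ≢ j → Far k (x i) (x j)

Rainbow : ℕ → (Fin m → Fin n → Bool) → Set
Rainbow k S = ∃ λ x → (∀ i → T (S i (x i))) × Separated k x

punchIn-≥ : ∀ (z : Fin (suc n)) x → toℕ x ≤ toℕ (punchIn z x)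
punchIn-≥ zero    x       = n≤1+n _
punchIn-≥ (suc z) zero    = z≤n
punchIn-≥ (suc z) (suc x) = s≤s (punchIn-≥ z x)

punchIn-≤ : ∀ (z : Fin (suc n)) x → toℕ (punchIn z x) ≤ suc (toℕ x)
punchIn-≤ zero    x       = ≤-refl
punchIn-≤ (suc z) zero    = z≤n
punchIn-≤ (suc z) (suc x) = s≤s (punchIn-≤ z x)

punchIn-dist-≥ : ∀ (z : Fin (suc n)) x y →
  ∣ toℕ x - toℕ y ∣ ≤ ∣ toℕ (punchIn z x) - toℕ (punchIn z y) ∣
punchIn-dist-≥ zero    x       y       = ≤-refl
punchIn-dist-≥ (suc z) zero    zero    = z≤n
punchIn-dist-≥ (suc z) zero    (suc y) = s≤s (punchIn-≥ z y)
punchIn-dist-≥ (suc z) (suc x) zero    = s≤s (punchIn-≥ z x)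
punchIn-dist-≥ (suc z) (suc x) (suc y) = punchIn-dist-≥ z x y

punchIn-dist-≤ : ∀ (z : Fin (suc n)) x y →
  ∣ toℕ (punchIn z x) - toℕ (punchIn z y) ∣ ≤ suc ∣ toℕ x - toℕ y ∣
punchIn-dist-≤ zero    x       y       = n≤1+n _
punchIn-dist-≤ (suc z) zero    zero    = z≤n
punchIn-dist-≤ (suc z) zero    (suc y) = s≤s (punchIn-≤ z y)
punchIn-dist-≤ (suc z) (suc x) zero    = s≤s (punchIn-≤ z x)
punchIn-dist-≤ (suc z) (suc x) (suc y) = punchIn-dist-≤ z x y

-- The two conditions in `Far` say that both ways around the cycle from x to y have length at least
-- k. Reinserting z lengthens one of the two by one and leaves the other unchanged.
punchIn-far : ∀ {k} (z : Fin (suc n)) {x y} → Far k x y → Far k (punchIn z x) (punchIn z y)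
punchIn-far {n} {k} z {x} {y} (k≤d , k+d≤n) = ≤-trans k≤d (punchIn-dist-≥ z x y) , (begin
  k + ∣ toℕ (punchIn z x) - toℕ (punchIn z y) ∣   ≤⟨ +-monoʳ-≤ k (punchIn-dist-≤ z x y) ⟩
  k + suc ∣ toℕ x - toℕ y ∣                       ≡⟨ +-suc k _ ⟩
  suc (k + ∣ toℕ x - toℕ y ∣)                     ≤⟨ s≤s k+d≤n ⟩
  suc n                                           ∎)
  where open ≤-Reasoning

punchIn-rainbow : ∀ {k} z (S : Fin m → Fin (suc n) → Bool) →
  Rainbow k (λ i → S i ∘ punchIn z) → Rainbow k S
punchIn-rainbow z S (x , x∈S , sep) =
  punchIn z ∘ x , x∈S , λ i j i≢j → punchIn-far z (sep i j i≢j)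

-- Here `combine (π i) c` is the point k π(i) + c of the residue class of c. Two distinct points of
-- the class differ by k d with 1 ≤ d ≤ s, which leaves at least k on the other side of a cycle of
-- length (s + 1) k.
class-separated : ∀ {s} k (c : Fin k) (π : Fin (suc s) → Fin (suc s)) → (∀ i j → i ≢ j → π i ≢ π j) →
  Separated k (λ i → combine (π i) c)
class-separated {s} k c π distinct i j i≢j =
  subst (k ≤_) (sym dist) (m≤m*n k d) ,
  (begin
    k + ∣ toℕ (combine (π i) c) - toℕ (combine (π j) c) ∣   ≡⟨ cong (k +_) dist ⟩
    k + k * d                                               ≤⟨ +-monoʳ-≤ k (*-monoʳ-≤ k d≤s) ⟩
    k + k * s                                               ≡⟨ cong (k +_) (*-comm k s) ⟩
    suc s * k                                               ∎)
  where
  open ≤-Reasoning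
  d = ∣ toℕ (π i) - toℕ (π j) ∣

  instance
    d≢0 : NonZero d
    d≢0 = ≢-nonZero (distinct i j i≢j ∘ toℕ-injective ∘ ∣m-n∣≡0⇒m≡n)

  d≤s : d ≤ s
  d≤s = ≤-trans (∣m-n∣≤m⊔n (toℕ (π i)) (toℕ (π j)))
                (⊔-lub (≤-pred (toℕ<n (π i))) (≤-pred (toℕ<n (π j))))

  dist : ∣ toℕ (combine (π i) c) - toℕ (combine (π j) c) ∣ ≡ k * d
  dist = trans
    (cong₂ ∣_-_∣ (trans (toℕ-combine (π i) c) (+-comm _ (toℕ c))) (trans (toℕ-combine (π j) c) (+-comm _ (toℕ c))))
    (trans (∣m+n-m+o∣≡∣n-o∣ (toℕ c) _ _) (sym (*-distribˡ-∣-∣ k _ _)))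

-- Only the first j + 1 of the s + 1 points are required to lie in S. The others are free, since in
-- the application they are assigned to sets that fill the cycle.
Dense : ℕ → (s : ℕ) → (Fin n → Bool) → ℕ → Set
Dense {n} k s S j = ∃ λ (x : Vector (Fin n) (suc s)) → Separated k x × (∀ i → toℕ i ≤ j → T (S (x i)))

punchIn-dense : ∀ {k} z (S : Fin (suc n) → Bool) j → Dense k s (S ∘ punchIn z) j → Dense k s S j
punchIn-dense z S j (x , sep , x∈S) = punchIn z ∘ x , (λ i l i≢l → punchIn-far z (sep i l i≢l)) , x∈S

-- On a cycle of length (s + 1) k some residue class mod k contains more than j points of S, and
-- these can be listed first. A longer cycle is shortened by deleting a point, chosen outside S if
-- possible so that S keeps its size.
dense : ∀ k .{{_ : NonZero k}} r (S : Fin (r + suc s * k) → Bool) j → j ≤ s → j * k < # S → Dense k s S j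
dense {s} k zero S j j≤s jk<#S = x , class-separated k c π (proj₂ (proj₂ sdr)) , x∈S
  where
  class : ∃ λ c → j < # (λ l → S (combine {suc s} l c))
  class = pigeonhole j (λ c → # (λ l → S (combine {suc s} l c))) (begin-strict
    k * j                                                    ≡⟨ *-comm k j ⟩
    j * k                                                    <⟨ jk<#S ⟩
    # S                                                      ≡⟨ ∑-combine (suc s) (λ x → ⟦ S x ⟧) ⟩
    ∑ (λ l → ∑ λ c → ⟦ S (combine {suc s} l c) ⟧)            ≡⟨ ∑-swap (λ l c → ⟦ S (combine {suc s} l c) ⟧) ⟩
    ∑ (λ c → # (λ l → S (combine {suc s} l c)))              ∎)
    where open ≤-Reasoning

  c = proj₁ class

  Q : Fin (suc s) → Fin (suc s) → Bool
  -- Beyond index j every point of the class is allowed, so `Q i` has s + 1 elements there; up to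
  -- index j it has at least j + 1.
  Q i l = (j Nat.<ᵇ toℕ i) ∨ S (combine l c)

  big : ∀ i → toℕ i < # (Q i)
  big i with j <? toℕ i
  ... | yes j<i = subst (toℕ i <_) (sym (#-full {S = Q i} λ l → T-∨ˡ (<⇒<ᵇ j<i))) (toℕ<n i)
    where
    T-∨ˡ : ∀ {a b} → T a → T (a ∨ b)
    T-∨ˡ {true} _ = tt
  ... | no  j≮i = ≤-trans (s≤s (≮⇒≥ j≮i)) (≤-trans (proj₂ class) (#-mono (λ l → S (combine {suc s} l c)) (Q i) λ l → T-∨ʳ {j Nat.<ᵇ toℕ i}))
    where
    T-∨ʳ : ∀ {a b} → T b → T (a ∨ b)
    T-∨ʳ {true}  _ = tt
    T-∨ʳ {false} t = t

  sdr = distinct-representatives Q big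
  π = proj₁ sdr

  x : Vector (Fin (suc s * k)) (suc s)
  x i = combine (π i) c

  x∈S : ∀ i → toℕ i ≤ j → T (S (x i))
  x∈S i i≤j = drop (λ j<i → ≤⇒≯ i≤j (<ᵇ⇒< j (toℕ i) j<i)) (proj₁ (proj₂ sdr) i)
    where
    drop : ∀ {a b} → ¬ T a → T (a ∨ b) → T b
    drop {true}  ¬t _ = ⊥-elim (¬t tt)
    drop {false} _  t = t
dense {s} k (suc r) S j j≤s jk<#S with all? (λ x → T? (S x))
-- When S is the whole cycle any point may go: at least (s + 1) k > j k points remain.
... | yes full = punchIn-dense zero S j (dense k r (S ∘ suc) j j≤s
  (subst (j * k <_) (sym (#-full {S = S ∘ suc} (full ∘ suc))) (<-≤-trans (*-monoˡ-< k (s≤s j≤s)) (m≤n+m _ r))))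
... | no ¬full with z , z∉S ← ¬∀⟶∃¬ _ _ (λ x → T? (S x)) ¬full =
  punchIn-dense z S j (dense k r (S ∘ punchIn z) j j≤s
    (subst (j * k <_) (trans (∑-punchIn z (λ y → ⟦ S y ⟧)) (cong (_+ # (S ∘ punchIn z)) (⟦⟧-false z∉S))) jk<#S))

-- The inequality on the circle.

-- (n/k − s)|S₀| + |S₁| + ⋯ + |Sₛ| ≤ s n, multiplied by k and with (s + 1) k |S₀|
-- added to both sides so that no subtraction occurs.
cyclic-bound : ∀ k .{{_ : NonZero k}} r (S : Fin (suc s) → Fin (r + suc s * k) → Bool) →
  (∀ i j → i Fin.≤ j → ∀ x → T (S i x) → T (S j x)) → ¬ Rainbow k S →
  (r + suc s * k) * # (S zero) + k * ∑ (λ i → # (S i)) ≤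
    s * k * (r + suc s * k) + suc s * k * # (S zero)
cyclic-bound {s} k zero S mono ¬rainbow = begin
  suc s * k * # (S zero) + k * ∑ (λ i → # (S i))         ≤⟨ +-monoʳ-≤ (suc s * k * # (S zero)) (*-monoʳ-≤ k total) ⟩
  suc s * k * # (S zero) + k * (k * (s * suc s))         ≡⟨ rearrange s k (# (S zero)) ⟩
  s * k * (suc s * k) + suc s * k * # (S zero)           ∎
  where
  open ≤-Reasoning
  rearrange : ∀ s k a → (1 + s) * k * a + k * (k * (s * (1 + s))) ≡ s * k * ((1 + s) * k) + (1 + s) * k * a
  rearrange = solve-∀

  b : Fin k → Fin (suc s) → ℕ
  b c i = # (λ l → S i (combine {suc s} l c))

  -- If every S_i had more than i points in the class, distinct representatives would give s + 1
  -- disjoint arcs. So some S_i has at most i points there, which `∑-monotone-≤` turns into a loss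
  -- of (i + 1)(s + 1 - i) from the maximum (s + 1)².
  class-bound : ∀ c → ∑ (b c) ≤ s * suc s
  class-bound c with all? (λ i → toℕ i <? b c i)
  ... | yes big with π , π∈S , distinct ← distinct-representatives (λ i l → S i (combine {suc s} l c)) big =
    contradiction ((λ i → combine (π i) c) , π∈S , class-separated k c π distinct) ¬rainbow
  ... | no ¬big with i , i≮b ← ¬∀⟶∃¬ _ _ (λ i → toℕ i <? b c i) ¬big = +-cancelʳ-≤ (suc s) _ _ (begin
    ∑ (b c) + suc s                         ≤⟨ +-monoʳ-≤ (∑ (b c)) few ⟩
    ∑ (b c) + suc (toℕ i) * (suc s ∸ toℕ i)   ≤⟨ ∑-monotone-≤ (b c) (λ i j i≤j → #-mono (λ l → S i (combine {suc s} l c)) (λ l → S j (combine {suc s} l c)) λ l → mono i j i≤j (combine l c)) all≤ i (≮⇒≥ i≮b) ⟩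
    suc s * (toℕ i + (suc s ∸ toℕ i))         ≡⟨ cong (suc s *_) whole ⟩
    suc s * suc s                             ≡⟨ +-comm (suc s) _ ⟩
    s * suc s + suc s                         ∎)
    where
    whole : toℕ i + (suc s ∸ toℕ i) ≡ suc s
    whole = m+[n∸m]≡n (<⇒≤ (toℕ<n i))
    all≤ : ∀ j → b c j ≤ toℕ i + (suc s ∸ toℕ i)
    all≤ j = ≤-trans (∑-≤ (λ l → ⟦⟧≤1 (S j (combine {suc s} l c)))) (≤-reflexive (trans (*-identityʳ (suc s)) (sym whole)))
    -- This is x y ≥ x + y - 1 for the positive numbers x = i + 1 and y = s + 1 - i.
    few : suc s ≤ suc (toℕ i) * (suc s ∸ toℕ i)
    few with suc s ∸ toℕ i | m<n⇒0<n∸m (toℕ<n i) | whole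
    ... | suc e | _ | eq = begin
      suc s                        ≡⟨ sym eq ⟩
      toℕ i + suc e                ≡⟨ +-comm (toℕ i) _ ⟩
      suc e + toℕ i                ≤⟨ +-monoʳ-≤ (suc e) (m≤m*n (toℕ i) (suc e)) ⟩
      suc e + toℕ i * suc e        ∎

  total : ∑ (λ i → # (S i)) ≤ k * (s * suc s)
  total = begin
    ∑ (λ i → # (S i))                 ≡⟨ ∑-cong (λ i → trans (∑-combine (suc s) (λ x → ⟦ S i x ⟧)) (∑-swap (λ l c → ⟦ S i (combine {suc s} l c) ⟧))) ⟩
    ∑ (λ i → ∑ λ c → b c i)           ≡⟨ ∑-swap (λ i c → b c i) ⟩
    ∑ (λ c → ∑ (b c))                 ≤⟨ ∑-≤ class-bound ⟩
    k * (s * suc s)                   ∎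
cyclic-bound {s} k (suc r) S mono ¬rainbow with last-failure (λ i → all? (λ x → T? (S i x)))
-- All sets are full, so any s + 1 disjoint arcs form a rainbow; `dense` for the whole cycle and j =
-- 0 provides them.
... | inj₁ full with x , sep , _ ← dense k (suc r) (λ _ → true) 0 z≤n (s≤s z≤n)
  = contradiction (x , (λ i → full i (x i)) , sep) ¬rainbow
... | inj₂ (j , ¬full , after) with z , z∉S ← ¬∀⟶∃¬ _ _ (λ x → T? (S j x)) ¬full = begin
  suc N * # (S zero) + k * ∑ (λ i → # (S i))     ≡⟨ cong₂ (λ a b → suc N * a + k * b) #S₀ #S ⟩
  suc N * a + k * (δ + σ)                        ≡⟨ expand N a k δ σ ⟩
  (a + k * δ) + (N * a + k * σ)                  ≤⟨ +-mono-≤ gain (cyclic-bound k r S′ mono′ (¬rainbow ∘ punchIn-rainbow z S)) ⟩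
  s * k + (s * k * N + suc s * k * a)            ≡⟨ collect s k N a ⟩
  s * k * suc N + suc s * k * a                  ≡⟨ cong (λ a → s * k * suc N + suc s * k * a) (sym #S₀) ⟩
  s * k * suc N + suc s * k * # (S zero)         ∎
  where
  open ≤-Reasoning
  N = r + suc s * k
  S′ : Fin (suc s) → Fin N → Bool
  S′ i = S i ∘ punchIn z
  a = # (S′ zero)
  σ = ∑ (λ i → # (S′ i))
  δ = ∑ (λ i → ⟦ S i z ⟧)

  mono′ : ∀ i j → i Fin.≤ j → ∀ x → T (S′ i x) → T (S′ j x)
  mono′ i j i≤j x = mono i j i≤j (punchIn z x)

  #S₀ : # (S zero) ≡ a
  #S₀ = trans (∑-punchIn z (λ y → ⟦ S zero y ⟧)) (cong (_+ a) (⟦⟧-false (z∉S ∘ mono zero j z≤n z)))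

  #S : ∑ (λ i → # (S i)) ≡ δ + σ
  #S = trans (∑-cong λ i → ∑-punchIn z (λ y → ⟦ S i y ⟧)) (∑-+ (λ i → ⟦ S i z ⟧) (λ i → # (S′ i)))

  a≤jk : a ≤ toℕ j * k
  a≤jk with # (S zero) ≤? toℕ j * k
  ... | yes le = subst (_≤ toℕ j * k) #S₀ le
  ... | no  ≰ with x , sep , x∈S ← dense k (suc r) (S zero) (toℕ j) (≤-pred (toℕ<n j)) (≰⇒> ≰)
    = contradiction (x , member , sep) ¬rainbow
    where
    member : ∀ i → T (S i (x i))
    member i with toℕ i ≤? toℕ j
    ... | yes i≤j = mono zero i z≤n (x i) (x∈S i i≤j)
    ... | no  i≰j = after i (≰⇒> i≰j) (x i)

  -- The sets with index at most j all miss z: the monotone sum bound with c = 0 and e = 1.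
  δ≤ : δ + toℕ j ≤ s
  δ≤ = +-cancelˡ-≤ 1 _ _ (begin
    1 + (δ + toℕ j)              ≡⟨ sym (+-suc δ (toℕ j)) ⟩
    δ + suc (toℕ j)              ≡⟨ cong (δ +_) (sym (*-identityʳ _)) ⟩
    δ + suc (toℕ j) * 1          ≤⟨ ∑-monotone-≤ (λ i → ⟦ S i z ⟧) (λ i l i≤l → ⟦⟧-mono (mono i l i≤l z))
                                      (λ i → ⟦⟧≤1 (S i z)) j (≤-reflexive (⟦⟧-false z∉S)) ⟩
    suc s * 1                    ≡⟨ *-identityʳ (suc s) ⟩
    suc s                        ∎)

  -- Deleting z lowers the left-hand side by a + k δ and the right-hand side by s k, so this
  -- inequality carries the induction.
  gain : a + k * δ ≤ s * k
  gain = begin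
    a + k * δ               ≤⟨ +-monoˡ-≤ (k * δ) a≤jk ⟩
    toℕ j * k + k * δ       ≡⟨ factor (toℕ j) k δ ⟩
    (δ + toℕ j) * k         ≤⟨ *-monoˡ-≤ k δ≤ ⟩
    s * k                   ∎
    where
    factor : ∀ j k δ → j * k + k * δ ≡ (δ + j) * k
    factor = solve-∀

  expand : ∀ n a k δ σ → (1 + n) * a + k * (δ + σ) ≡ (a + k * δ) + (n * a + k * σ)
  expand = solve-∀
  collect : ∀ s k n a → s * k + (s * k * n + (1 + s) * k * a) ≡ s * k * (1 + n) + (1 + s) * k * a
  collect = solve-∀

-- Arcs as subsets of [n].

-- The last disjunct is the part of the arc that wraps around 0.
inArc : ℕ → Fin n → Fin n → Bool
inArc {n} k x y = (not (toℕ y Nat.<ᵇ toℕ x) ∧ (toℕ y Nat.<ᵇ toℕ x + k)) ∨ (n + toℕ y Nat.<ᵇ toℕ x + k)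

arc : ℕ → Fin n → Subset n
arc k x = tabulate (inArc k x)

-- The offset o absorbs the shift of y in the induction; with o = n it counts the points that an arc
-- reaches after wrapping around.
count-< : ∀ n o c → ∑ {n} (λ y → ⟦ o + toℕ y Nat.<ᵇ c ⟧) ≡ n ⊓ (c ∸ o)
count-< zero    o c = refl
count-< (suc n) o c = trans
  (cong₂ _+_ (cong (λ a → ⟦ a Nat.<ᵇ c ⟧) (+-identityʳ o))
             (trans (∑-cong {n} (λ y → cong (λ a → ⟦ a Nat.<ᵇ c ⟧) (+-suc o (toℕ y)))) (count-< n (suc o) c)))
  step
  where
  step : ⟦ o Nat.<ᵇ c ⟧ + n ⊓ (c ∸ suc o) ≡ suc n ⊓ (c ∸ o)
  step with o <? c
  ... | yes o<c rewrite ⟦⟧-true (<⇒<ᵇ o<c) | sym (suc-pred (c ∸ o) {{>-nonZero (m<n⇒0<n∸m o<c)}}) | pred[m∸n]≡m∸[1+n] c o = refl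
  ... | no  o≮c rewrite ⟦⟧-false (o≮c ∘ <ᵇ⇒< o c) | m≤n⇒m∸n≡0 (≮⇒≥ o≮c) | m≤n⇒m∸n≡0 (m≤n⇒m≤1+n (≮⇒≥ o≮c)) = ⊓-zeroʳ n

∣tabulate∣ : (S : Fin n → Bool) → ∣ tabulate S ∣ ≡ # S
∣tabulate∣ {zero}  S = refl
∣tabulate∣ {suc n} S with S zero
... | true  = cong suc (∣tabulate∣ (S ∘ suc))
... | false = ∣tabulate∣ (S ∘ suc)

-- Counted with multiplicity, the arc together with the points below x is the union of the initial
-- segments y < x + k and n + y < x + k. The second lies below x because k ≤ n.
∣arc∣ : ∀ {k} → k ≤ n → (x : Fin n) → ∣ arc k x ∣ ≡ k
∣arc∣ {n} {k} k≤n x = +-cancelʳ-≡ (toℕ x) _ _ (begin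
  ∣ arc k x ∣ + toℕ x
    ≡⟨ cong₂ _+_ (∣tabulate∣ (inArc k x)) (sym (trans (count-< n 0 (toℕ x)) (m≥n⇒m⊓n≡n (<⇒≤ (toℕ<n x))))) ⟩
  # (inArc k x) + ∑ {n} (λ y → ⟦ toℕ y Nat.<ᵇ toℕ x ⟧)
    ≡⟨ sym (∑-+ {n} (λ y → ⟦ inArc k x y ⟧) (λ y → ⟦ toℕ y Nat.<ᵇ toℕ x ⟧)) ⟩
  ∑ {n} (λ y → ⟦ inArc k x y ⟧ + ⟦ toℕ y Nat.<ᵇ toℕ x ⟧)
    ≡⟨ ∑-cong pointwise ⟩
  ∑ {n} (λ y → ⟦ toℕ y Nat.<ᵇ toℕ x + k ⟧ + ⟦ n + toℕ y Nat.<ᵇ toℕ x + k ⟧)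
    ≡⟨ ∑-+ {n} (λ y → ⟦ toℕ y Nat.<ᵇ toℕ x + k ⟧) (λ y → ⟦ n + toℕ y Nat.<ᵇ toℕ x + k ⟧) ⟩
  ∑ {n} (λ y → ⟦ toℕ y Nat.<ᵇ toℕ x + k ⟧) + ∑ {n} (λ y → ⟦ n + toℕ y Nat.<ᵇ toℕ x + k ⟧)
    ≡⟨ cong₂ _+_ (count-< n 0 (toℕ x + k)) (trans (count-< n n (toℕ x + k)) (m≥n⇒m⊓n≡n excess≤n)) ⟩
  n ⊓ (toℕ x + k) + (toℕ x + k ∸ n)
    ≡⟨ m⊓n+n∸m≡n n (toℕ x + k) ⟩
  toℕ x + k
    ≡⟨ +-comm (toℕ x) k ⟩
  k + toℕ x
    ∎)
  where
  open ≡-Reasoning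
  excess≤n : toℕ x + k ∸ n ≤ n
  excess≤n = m≤n+o⇒m∸n≤o (toℕ x + k) n (+-mono-≤ (<⇒≤ (toℕ<n x)) k≤n)

  pointwise : ∀ y → ⟦ inArc k x y ⟧ + ⟦ toℕ y Nat.<ᵇ toℕ x ⟧ ≡
                    ⟦ toℕ y Nat.<ᵇ toℕ x + k ⟧ + ⟦ n + toℕ y Nat.<ᵇ toℕ x + k ⟧
  pointwise y = cases (toℕ y Nat.<ᵇ toℕ x) (toℕ y Nat.<ᵇ toℕ x + k) (n + toℕ y Nat.<ᵇ toℕ x + k)
    (λ y<x → <⇒<ᵇ (<-≤-trans (<ᵇ⇒< (toℕ y) _ y<x) (m≤m+n (toℕ x) k)))
    (λ n+y<x+k → <⇒<ᵇ (+-cancelˡ-< k _ _ (≤-<-trans (+-monoˡ-≤ (toℕ y) k≤n)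
                   (<-≤-trans (<ᵇ⇒< (n + toℕ y) _ n+y<x+k) (≤-reflexive (+-comm (toℕ x) k))))))
    where
    cases : ∀ a b c → (T a → T b) → (T c → T a) → ⟦ (not a ∧ b) ∨ c ⟧ + ⟦ a ⟧ ≡ ⟦ b ⟧ + ⟦ c ⟧
    cases true  true  true  _ _ = refl
    cases true  true  false _ _ = refl
    cases true  false c     f _ = ⊥-elim (f tt)
    cases false b     true  _ g = ⊥-elim (g tt)
    cases false true  false _ _ = refl
    cases false false false _ _ = refl

∈arc : ∀ {k} {x y : Fin n} → y ∈ arc k x →
  (toℕ x ≤ toℕ y × toℕ y < toℕ x + k) ⊎ n + toℕ y < toℕ x + k
∈arc {n} {k} {x} {y} y∈ = cases (toℕ y Nat.<ᵇ toℕ x) (toℕ y Nat.<ᵇ toℕ x + k) (n + toℕ y Nat.<ᵇ toℕ x + k)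
  (λ ¬y<x → ≮⇒≥ (¬y<x ∘ <⇒<ᵇ)) (<ᵇ⇒< (toℕ y) _) (<ᵇ⇒< (n + toℕ y) _)
  (subst T (trans (sym ([]=⇒lookup y∈)) (lookup∘tabulate (inArc k x) y)) tt)
  where
  cases : ∀ a b c {A B C : Set} → (¬ T a → A) → (T b → B) → (T c → C) → T ((not a ∧ b) ∨ c) → (A × B) ⊎ C
  cases false true  c    f g h t = inj₁ (f (λ ()) , g tt)
  cases false false true f g h t = inj₂ (h tt)
  cases true  b     true f g h t = inj₂ (h tt)

-- The condition k ≤ d makes the arc at x end before x′, so that it cannot wrap. The condition k + d
-- ≤ n makes the wrapped part of the arc at x′ end before x.
arcs-disjoint-≤ : ∀ {k} {x x′ y : Fin n} → toℕ x ≤ toℕ x′ → Far k x x′ → y ∈ arc k x → ¬ y ∈ arc k x′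
arcs-disjoint-≤ {n} {k} {x} {x′} {y} x≤x′ (k≤d , k+d≤n) y∈x y∈x′ with ∈arc y∈x | ∈arc y∈x′
... | inj₁ (_ , y<x+k) | inj₁ (x′≤y , _) = <⇒≱ y<x+k (≤-trans x+k≤x′ x′≤y)
  where
  x+k≤x′ : toℕ x + k ≤ toℕ x′
  x+k≤x′ = ≤-trans (+-monoʳ-≤ (toℕ x) (≤-trans k≤d (≤-reflexive (m≤n⇒∣m-n∣≡n∸m x≤x′))))
                   (≤-reflexive (m+[n∸m]≡n x≤x′))
... | inj₁ (x≤y , _) | inj₂ n+y<x′+k = <⇒≱ n+y<x′+k (begin
  toℕ x′ + k                              ≡⟨ cong (_+ k) (sym (m+[n∸m]≡n x≤x′)) ⟩
  toℕ x + (toℕ x′ ∸ toℕ x) + k            ≡⟨ cong (λ d → toℕ x + d + k) (sym (m≤n⇒∣m-n∣≡n∸m x≤x′)) ⟩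
  toℕ x + ∣ toℕ x - toℕ x′ ∣ + k          ≡⟨ rotate (toℕ x) _ k ⟩
  (k + ∣ toℕ x - toℕ x′ ∣) + toℕ x        ≤⟨ +-mono-≤ k+d≤n x≤y ⟩
  n + toℕ y                               ∎)
  where
  open ≤-Reasoning
  rotate : ∀ a b c → a + b + c ≡ (c + b) + a
  rotate = solve-∀
... | inj₂ n+y<x+k | _ = <⇒≱ n+y<x+k (begin
  toℕ x + k                               ≤⟨ +-monoʳ-≤ (toℕ x) k≤d ⟩
  toℕ x + ∣ toℕ x - toℕ x′ ∣              ≡⟨ cong (toℕ x +_) (m≤n⇒∣m-n∣≡n∸m x≤x′) ⟩
  toℕ x + (toℕ x′ ∸ toℕ x)                ≡⟨ m+[n∸m]≡n x≤x′ ⟩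
  toℕ x′                                  ≤⟨ <⇒≤ (toℕ<n x′) ⟩
  n                                       ≤⟨ m≤m+n n (toℕ y) ⟩
  n + toℕ y                               ∎)
  where open ≤-Reasoning

arcs-disjoint : ∀ {k} (x x′ : Fin n) → Far k x x′ → Empty (arc k x ∩ arc k x′)
arcs-disjoint {n} {k} x x′ far (y , y∈) with x∈p∩q⁻ (arc k x) (arc k x′) y∈ | ≤-total (toℕ x) (toℕ x′)
... | y∈x , y∈x′ | inj₁ x≤x′ = arcs-disjoint-≤ x≤x′ far y∈x y∈x′
... | y∈x , y∈x′ | inj₂ x′≤x =
  arcs-disjoint-≤ x′≤x (subst (λ d → k ≤ d × k + d ≤ n) (∣-∣-comm (toℕ x) (toℕ x′)) far) y∈x′ y∈x

-- Sums over all subsets.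

-- Recursion on the first coordinate replaces the list `subsets`; `card-∑ₛ` shows that both count
-- alike.
∑ₛ : (Subset n → ℕ) → ℕ
∑ₛ {zero}  g = g Vec.[]
∑ₛ {suc n} g = ∑ₛ (g ∘ (outside Vec.∷_)) + ∑ₛ (g ∘ (inside Vec.∷_))

∑ₛ-cong : {g h : Subset n → ℕ} → (∀ A → g A ≡ h A) → ∑ₛ g ≡ ∑ₛ h
∑ₛ-cong {zero}  eq = eq Vec.[]
∑ₛ-cong {suc n} eq = cong₂ _+_ (∑ₛ-cong (eq ∘ (outside Vec.∷_))) (∑ₛ-cong (eq ∘ (inside Vec.∷_)))

∑ₛ-+ : (g h : Subset n → ℕ) → ∑ₛ (λ A → g A + h A) ≡ ∑ₛ g + ∑ₛ h
∑ₛ-+ {zero}  g h = refl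
∑ₛ-+ {suc n} g h = trans (cong₂ _+_ (∑ₛ-+ (g ∘ (outside Vec.∷_)) (h ∘ (outside Vec.∷_)))
                                    (∑ₛ-+ (g ∘ (inside Vec.∷_)) (h ∘ (inside Vec.∷_))))
                         (interchange (∑ₛ (g ∘ (outside Vec.∷_))) _ _ _)
  where
  interchange : ∀ a b c d → (a + b) + (c + d) ≡ (a + c) + (b + d)
  interchange = solve-∀

∑ₛ-*ˡ : ∀ c (g : Subset n → ℕ) → ∑ₛ (λ A → c * g A) ≡ c * ∑ₛ g
∑ₛ-*ˡ {zero}  c g = refl
∑ₛ-*ˡ {suc n} c g = trans (cong₂ _+_ (∑ₛ-*ˡ c (g ∘ (outside Vec.∷_))) (∑ₛ-*ˡ c (g ∘ (inside Vec.∷_))))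
                          (sym (*-distribˡ-+ c _ _))

card-∑ₛ : (ℬ : Family n) → card ℬ ≡ ∑ₛ (λ A → ⟦ ℬ A ⟧)
card-∑ₛ {zero} ℬ with ℬ Vec.[]
... | true  = refl
... | false = refl
card-∑ₛ {suc n} ℬ = begin
  List.length (List.filterᵇ ℬ (List.map (outside Vec.∷_) (subsets n) List.++ List.map (inside Vec.∷_) (subsets n)))
    ≡⟨ cong List.length (filter-++ (T? ∘ ℬ) (List.map (outside Vec.∷_) (subsets n)) _) ⟩
  List.length (List.filterᵇ ℬ (List.map (outside Vec.∷_) (subsets n)) List.++ List.filterᵇ ℬ (List.map (inside Vec.∷_) (subsets n)))
    ≡⟨ length-++ (List.filterᵇ ℬ (List.map (outside Vec.∷_) (subsets n))) ⟩
  List.length (List.filterᵇ ℬ (List.map (outside Vec.∷_) (subsets n))) + List.length (List.filterᵇ ℬ (List.map (inside Vec.∷_) (subsets n)))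
    ≡⟨ cong₂ _+_ (half outside) (half inside) ⟩
  ∑ₛ (λ A → ⟦ ℬ A ⟧)
    ∎
  where
  open ≡-Reasoning
  length-filter-map : ∀ b (As : List.List (Subset n)) →
    List.length (List.filterᵇ ℬ (List.map (b Vec.∷_) As)) ≡ List.length (List.filterᵇ (ℬ ∘ (b Vec.∷_)) As)
  length-filter-map b List.[] = refl
  length-filter-map b (A List.∷ As) with ℬ (b Vec.∷ A)
  ... | true  = cong suc (length-filter-map b As)
  ... | false = length-filter-map b As

  half : ∀ b → List.length (List.filterᵇ ℬ (List.map (b Vec.∷_) (subsets n))) ≡ ∑ₛ (λ A → ⟦ ℬ (b Vec.∷ A) ⟧)
  half b = trans (length-filter-map b (subsets n)) (card-∑ₛ (ℬ ∘ (b Vec.∷_)))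

∑ₛ-mono : {g h : Subset n → ℕ} → (∀ A → g A ≤ h A) → ∑ₛ g ≤ ∑ₛ h
∑ₛ-mono {zero}  le = le Vec.[]
∑ₛ-mono {suc n} le = +-mono-≤ (∑ₛ-mono (le ∘ (outside Vec.∷_))) (∑ₛ-mono (le ∘ (inside Vec.∷_)))

card-mono : {ℬ 𝒞 : Family n} → ℬ ⊆ᶠ 𝒞 → card ℬ ≤ card 𝒞
card-mono {ℬ = ℬ} {𝒞} ℬ⊆𝒞 = subst₂ _≤_ (sym (card-∑ₛ ℬ)) (sym (card-∑ₛ 𝒞)) (∑ₛ-mono λ A → ⟦⟧-mono (ℬ⊆𝒞 A))

-- Permutations and their action on subsets.

-- One count for either bit, so that members and non-members of a set are treated alike when a
-- coordinate is inserted.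
occ : Bool → Subset n → ℕ
occ b = Vec.count (b Bool.≟_)

occ-inside : (A : Subset n) → occ inside A ≡ ∣ A ∣
occ-inside Vec.[]            = refl
occ-inside (inside Vec.∷ A)  = cong suc (occ-inside A)
occ-inside (outside Vec.∷ A) = occ-inside A

occ-sum : (A : Subset n) → occ inside A + occ outside A ≡ n
occ-sum Vec.[]            = refl
occ-sum (inside Vec.∷ A)  = cong suc (occ-sum A)
occ-sum (outside Vec.∷ A) = trans (+-suc _ _) (cong suc (occ-sum A))

occ-outside : (A : Subset n) → occ outside A ≡ n ∸ ∣ A ∣
occ-outside {n} A = trans (sym (m+n∸m≡n (occ inside A) _)) (cong₂ _∸_ (occ-sum A) (occ-inside A))

occ-≡ : ∀ b {A A′ : Subset n} → ∣ A ∣ ≡ ∣ A′ ∣ → occ b A ≡ occ b A′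
occ-≡ true  {A} {A′} eq = trans (occ-inside A) (trans eq (sym (occ-inside A′)))
occ-≡ false {A} {A′} eq = trans (occ-outside A) (trans (cong (_ ∸_) eq) (sym (occ-outside A′)))

∣∷∣ : ∀ b (A : Subset n) → ∣ b Vec.∷ A ∣ ≡ ⟦ b ⟧ + ∣ A ∣
∣∷∣ true  A = refl
∣∷∣ false A = refl

∣insertAt∣ : ∀ (A : Subset n) y b → ∣ insertAt A y b ∣ ≡ ⟦ b ⟧ + ∣ A ∣
∣insertAt∣ A             zero    b = ∣∷∣ b A
∣insertAt∣ (c Vec.∷ A) (suc y) b = begin
  ∣ c Vec.∷ insertAt A y b ∣       ≡⟨ ∣∷∣ c (insertAt A y b) ⟩
  ⟦ c ⟧ + ∣ insertAt A y b ∣       ≡⟨ cong (⟦ c ⟧ +_) (∣insertAt∣ A y b) ⟩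
  ⟦ c ⟧ + (⟦ b ⟧ + ∣ A ∣)          ≡⟨ swap ⟦ c ⟧ ⟦ b ⟧ ∣ A ∣ ⟩
  ⟦ b ⟧ + (⟦ c ⟧ + ∣ A ∣)          ≡⟨ cong (⟦ b ⟧ +_) (sym (∣∷∣ c A)) ⟩
  ⟦ b ⟧ + ∣ c Vec.∷ A ∣            ∎
  where
  open ≡-Reasoning
  swap : ∀ x y z → x + (y + z) ≡ y + (x + z)
  swap = solve-∀

-- Double counting: a subset of [n + 1] arises by inserting the bit b once for each coordinate at
-- which it has the value b.
∑-insertAt : ∀ b (g : Subset (suc n) → ℕ) →
  ∑ (λ y → ∑ₛ λ A → g (insertAt A y b)) ≡ ∑ₛ (λ A → occ b A * g A)
∑-insertAt {zero} true  g = refl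
∑-insertAt {zero} false g = sym (+-identityʳ _)
∑-insertAt {suc n} b g = begin
  ∑ₛ (λ A → g (b Vec.∷ A)) + ∑ (λ y → ∑ₛ (λ A → g (outside Vec.∷ insertAt A y b)) + ∑ₛ (λ A → g (inside Vec.∷ insertAt A y b)))
    ≡⟨ cong (∑ₛ (λ A → g (b Vec.∷ A)) +_) (∑-+ (λ y → ∑ₛ (λ A → g (outside Vec.∷ insertAt A y b))) (λ y → ∑ₛ (λ A → g (inside Vec.∷ insertAt A y b)))) ⟩
  ∑ₛ (λ A → g (b Vec.∷ A)) + (∑ (λ y → ∑ₛ (λ A → g (outside Vec.∷ insertAt A y b))) + ∑ (λ y → ∑ₛ (λ A → g (inside Vec.∷ insertAt A y b))))
    ≡⟨ cong (∑ₛ (λ A → g (b Vec.∷ A)) +_) (cong₂ _+_ (∑-insertAt b (g ∘ (outside Vec.∷_))) (∑-insertAt b (g ∘ (inside Vec.∷_)))) ⟩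
  ∑ₛ (λ A → g (b Vec.∷ A)) + (∑ₛ (λ A → occ b A * g (outside Vec.∷ A)) + ∑ₛ (λ A → occ b A * g (inside Vec.∷ A)))
    ≡⟨ absorb b ⟩
  ∑ₛ (λ A → occ b A * g A)
    ∎
  where
  open ≡-Reasoning
  absorb : ∀ b → ∑ₛ (λ A → g (b Vec.∷ A)) + (∑ₛ (λ A → occ b A * g (outside Vec.∷ A)) + ∑ₛ (λ A → occ b A * g (inside Vec.∷ A))) ≡
                 ∑ₛ (λ A → occ b A * g A)
  absorb false = trans (sym (+-assoc (∑ₛ (λ A → g (outside Vec.∷ A))) _ _))
    (cong (_+ ∑ₛ (λ A → occ false A * g (inside Vec.∷ A)))
      (sym (∑ₛ-+ (λ A → g (outside Vec.∷ A)) (λ A → occ false A * g (outside Vec.∷ A)))))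
  absorb true = trans (swap (∑ₛ (λ A → g (inside Vec.∷ A))) (∑ₛ (λ A → occ true A * g (outside Vec.∷ A))) _)
    (cong (∑ₛ (λ A → occ true A * g (outside Vec.∷ A)) +_)
      (sym (∑ₛ-+ (λ A → g (inside Vec.∷ A)) (λ A → occ true A * g (inside Vec.∷ A)))))
    where
    swap : ∀ x y z → x + (y + z) ≡ y + (x + z)
    swap = solve-∀

-- Fin (n !) enumerates the permutations of [n]: the quotient of σ by n ! is the
-- image of the first point, and the remainder permutes the remaining ones.
act : ∀ n → Fin (n !) → Subset n → Subset n
act zero    σ A           = A
act (suc n) σ (b Vec.∷ A) = insertAt (act n (proj₂ (remQuot {suc n} (n !) σ)) A) (proj₁ (remQuot {suc n} (n !) σ)) b

act-combine : ∀ n y τ b (A : Subset n) →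
  act (suc n) (combine y τ) (b Vec.∷ A) ≡ insertAt (act n τ A) y b
act-combine n y τ b A =
  cong (λ (y , τ) → insertAt (act n τ A) y b) (remQuot-combine {suc n} {n !} y τ)

insertAt-∩ : ∀ (A A′ : Subset n) y b b′ →
  insertAt (A ∩ A′) y (b ∧ b′) ≡ insertAt A y b ∩ insertAt A′ y b′
insertAt-∩ A           A′            zero    b b′ = refl
insertAt-∩ (a Vec.∷ A) (a′ Vec.∷ A′) (suc y) b b′ = cong (a ∧ a′ Vec.∷_) (insertAt-∩ A A′ y b b′)

insertAt-⊥ : ∀ (y : Fin (suc n)) → insertAt ⊥ y outside ≡ ⊥
insertAt-⊥         zero    = refl
insertAt-⊥ {suc n} (suc y) = cong (outside Vec.∷_) (insertAt-⊥ y)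

act-∩ : ∀ n σ (A A′ : Subset n) → act n σ (A ∩ A′) ≡ act n σ A ∩ act n σ A′
act-∩ zero    σ Vec.[]      Vec.[]        = refl
act-∩ (suc n) σ (b Vec.∷ A) (b′ Vec.∷ A′) =
  trans (cong (λ A → insertAt A _ (b ∧ b′)) (act-∩ n _ A A′)) (insertAt-∩ _ _ _ b b′)

act-⊥ : ∀ n σ → act n σ ⊥ ≡ ⊥
act-⊥ zero    σ = refl
act-⊥ (suc n) σ = trans (cong (λ A → insertAt A (proj₁ (remQuot {suc n} (n !) σ)) outside) (act-⊥ n _)) (insertAt-⊥ (proj₁ (remQuot {suc n} (n !) σ)))

act-disjoint : ∀ σ {A A′ : Subset n} → Empty (A ∩ A′) → Empty (act n σ A ∩ act n σ A′)
act-disjoint {n} σ {A} {A′} disjoint = subst Empty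
  (sym (trans (sym (act-∩ n σ A A′)) (trans (cong (act n σ) (Empty-unique disjoint)) (act-⊥ n σ))))
  λ (_ , x∈⊥) → ∉⊥ x∈⊥

-- Each set of the size of A is the image of A under |A|! (n - |A|)! permutations. Inductively, the
-- choice of the image of the first point contributes the factor `occ b`, which extends one of the
-- two factorials.
∑-act : ∀ (ℬ : Family n) A → Uniform ∣ A ∣ ℬ →
  ∑ (λ σ → ⟦ ℬ (act n σ A) ⟧) ≡ occ inside A ! * occ outside A ! * ∑ₛ (λ B → ⟦ ℬ B ⟧)
∑-act {zero}  ℬ Vec.[] uniform = refl
∑-act {suc n} ℬ (b Vec.∷ A) uniform = begin
  ∑ (λ σ → ⟦ ℬ (act (suc n) σ (b Vec.∷ A)) ⟧)
    ≡⟨ ∑-combine (suc n) (λ σ → ⟦ ℬ (act (suc n) σ (b Vec.∷ A)) ⟧) ⟩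
  ∑ (λ y → ∑ λ τ → ⟦ ℬ (act (suc n) (combine {suc n} y τ) (b Vec.∷ A)) ⟧)
    ≡⟨ ∑-cong (λ y → trans (∑-cong λ τ → cong (λ B → ⟦ ℬ B ⟧) (act-combine n y τ b A))
                            (∑-act (λ B → ℬ (insertAt B y b)) A (uniform′ y))) ⟩
  ∑ (λ y → w * ∑ₛ λ B → ⟦ ℬ (insertAt B y b) ⟧)
    ≡⟨ ∑-*ˡ w (λ y → ∑ₛ λ B → ⟦ ℬ (insertAt B y b) ⟧) ⟩
  w * ∑ (λ y → ∑ₛ λ B → ⟦ ℬ (insertAt B y b) ⟧)
    ≡⟨ cong (w *_) (∑-insertAt b (λ B → ⟦ ℬ B ⟧)) ⟩
  w * ∑ₛ (λ B → occ b B * ⟦ ℬ B ⟧)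
    ≡⟨ cong (w *_) (∑ₛ-cong occ-constant) ⟩
  w * ∑ₛ (λ B → occ b (b Vec.∷ A) * ⟦ ℬ B ⟧)
    ≡⟨ cong (w *_) (∑ₛ-*ˡ (occ b (b Vec.∷ A)) (λ B → ⟦ ℬ B ⟧)) ⟩
  w * (occ b (b Vec.∷ A) * ∑ₛ (λ B → ⟦ ℬ B ⟧))
    ≡⟨ factorials b (∑ₛ (λ B → ⟦ ℬ B ⟧)) ⟩
  occ inside (b Vec.∷ A) ! * occ outside (b Vec.∷ A) ! * ∑ₛ (λ B → ⟦ ℬ B ⟧)
    ∎
  where
  open ≡-Reasoning
  w = occ inside A ! * occ outside A !

  uniform′ : ∀ y → Uniform ∣ A ∣ (λ B → ℬ (insertAt B y b))
  uniform′ y B B∈ = +-cancelˡ-≡ ⟦ b ⟧ _ _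
    (trans (sym (∣insertAt∣ B y b)) (trans (uniform (insertAt B y b) B∈) (∣∷∣ b A)))

  -- Members of ℬ all have the size of the set acted on, and for the other sets both sides vanish.
  occ-constant : ∀ B → occ b B * ⟦ ℬ B ⟧ ≡ occ b (b Vec.∷ A) * ⟦ ℬ B ⟧
  occ-constant B with ℬ B in B∈
  ... | true  = cong (_* 1) (occ-≡ b {B} {b Vec.∷ A} (uniform B (subst T (sym B∈) tt)))
  ... | false = trans (*-zeroʳ (occ b B)) (sym (*-zeroʳ (occ b (b Vec.∷ A))))

  factorials : ∀ b g → w * (occ b (b Vec.∷ A) * g) ≡ occ inside (b Vec.∷ A) ! * occ outside (b Vec.∷ A) ! * g
  factorials true  g = arith (occ inside A !) (occ outside A !) (occ inside A) g
    where
    arith : ∀ x y c g → x * y * ((1 + c) * g) ≡ (1 + c) * x * y * g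
    arith = solve-∀
  factorials false g = arith (occ inside A !) (occ outside A !) (occ outside A) g
    where
    arith : ∀ x y c g → x * y * ((1 + c) * g) ≡ x * ((1 + c) * y) * g
    arith = solve-∀

-- Averaging over all orderings.

chain-monotone : (ℬ : Vector (Family n) (suc s)) → (∀ (i : Fin s) → ℬ (inject₁ i) ⊆ᶠ ℬ (suc i)) →
  ∀ i j → i Fin.≤ j → ℬ i ⊆ᶠ ℬ j
chain-monotone ℬ chain zero zero _ A = λ A∈ → A∈
chain-monotone {s = suc s} ℬ chain zero (suc j) _ A =
  chain-monotone (ℬ ∘ suc) (chain ∘ suc) zero j z≤n A ∘ chain zero A
chain-monotone {s = suc s} ℬ chain (suc i) (suc j) (s≤s i≤j) =
  chain-monotone (ℬ ∘ suc) (chain ∘ suc) i j i≤j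

-- A permutation preserves disjointness, so a rainbow on the cycle would be a rainbow matching of
-- size s + 1.
overlapping⇒¬rainbow : ∀ {k} (ℬ : Vector (Family n) (suc s)) → Overlapping ℬ → ∀ σ →
  ¬ Rainbow k (λ i x → ℬ i (act n σ (arc k x)))
overlapping⇒¬rainbow {n} {s} {k} ℬ overlapping σ (x , x∈ , separated) =
  <⇒≱ (proj₂ (ν-isMaximum ℬ) (suc s) matching) overlapping
  where
  matching : RainbowMatching ℬ (suc s)
  matching = ⊤ , (λ i → act n σ (arc k (x i))) , ∣⊤∣≡n (suc s) , (λ i _ → x∈ i) ,
             λ i j _ _ i≢j → act-disjoint σ (arcs-disjoint (x i) (x j) (separated i j i≢j))

nCk*k!*[n∸k]! : ∀ {n k} → k ≤ n → (n C k) * (k ! * (n ∸ k) !) ≡ n !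
nCk*k!*[n∸k]! {n} {k} k≤n =
  trans (cong (_* (k ! * (n ∸ k) !)) (nCk≡n!/k![n-k]! k≤n))
        (m/n*n≡m {{k !* (n ∸ k) !≢0}} (k![n∸k]!∣n! k≤n))

absorption : ∀ {n k} → k ≤ n → suc k * (suc n C suc k) ≡ suc n * (n C k)
absorption {n} {k} k≤n = *-cancelʳ-≡ _ _ (k ! * (n ∸ k) !) {{k !* (n ∸ k) !≢0}} (begin
  suc k * (suc n C suc k) * (k ! * (n ∸ k) !)    ≡⟨ rearrange k (suc n C suc k) (k !) ((n ∸ k) !) ⟩
  (suc n C suc k) * (suc k * k ! * (n ∸ k) !)    ≡⟨ nCk*k!*[n∸k]! (s≤s k≤n) ⟩
  suc n * n !                                    ≡⟨ cong (suc n *_) (sym (nCk*k!*[n∸k]! k≤n)) ⟩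
  suc n * ((n C k) * (k ! * (n ∸ k) !))          ≡⟨ sym (*-assoc (suc n) (n C k) _) ⟩
  suc n * (n C k) * (k ! * (n ∸ k) !)            ∎)
  where
  open ≡-Reasoning
  rearrange : ∀ k c x y → (1 + k) * c * (x * y) ≡ c * ((1 + k) * x * y)
  rearrange = solve-∀

-- With the sums exchanged, each of the n arcs is carried onto each member of ℬ by k! (n - k)!
-- permutations.
∑-arcs : ∀ {k} → k ≤ n → (ℬ : Family n) → Uniform k ℬ →
  ∑ (λ σ → # (λ x → ℬ (act n σ (arc k x)))) ≡ n * (k ! * (n ∸ k) !) * card ℬ
∑-arcs {n} {k} k≤n ℬ uniform = begin
  ∑ (λ σ → ∑ λ x → ⟦ ℬ (act n σ (arc k x)) ⟧)    ≡⟨ ∑-swap (λ σ x → ⟦ ℬ (act n σ (arc k x)) ⟧) ⟩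
  ∑ (λ x → ∑ λ σ → ⟦ ℬ (act n σ (arc k x)) ⟧)    ≡⟨ ∑-cong one-arc ⟩
  ∑ {n} (λ _ → k ! * (n ∸ k) ! * card ℬ)         ≡⟨ ∑-const n _ ⟩
  n * (k ! * (n ∸ k) ! * card ℬ)                 ≡⟨ sym (*-assoc n _ (card ℬ)) ⟩
  n * (k ! * (n ∸ k) !) * card ℬ                 ∎
  where
  open ≡-Reasoning
  one-arc : ∀ x → ∑ (λ σ → ⟦ ℬ (act n σ (arc k x)) ⟧) ≡ k ! * (n ∸ k) ! * card ℬ
  one-arc x = trans (∑-act ℬ (arc k x) (subst (λ k → Uniform k ℬ) (sym size) uniform))
    (cong₂ _*_ (cong₂ (λ a b → a ! * b !) (trans (occ-inside (arc k x)) size)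
                                          (trans (occ-outside (arc k x)) (cong (n ∸_) size)))
               (sym (card-∑ₛ ℬ)))
    where
    size = ∣arc∣ k≤n x

-- The circle inequality is summed over all n! permutations and W = n k! (n - k)! is cancelled;
-- C(n,k) appears through n! = C(n,k) k! (n - k)!.
averaged-bound : ∀ n k .{{_ : NonZero k}} (ℬ : Vector (Family n) (suc s)) → suc s * k ≤ n → Admissible n k s ℬ →
  n * card (ℬ zero) + k * ∑ (λ i → card (ℬ i)) ≤ s * k * (n C k) + suc s * k * card (ℬ zero)
averaged-bound {s} n k ℬ [1+s]k≤n (chain , uniform , overlapping) =
  *-cancelˡ-≤ W {{W≢0}} (begin
    W * (n * b zero + k * ∑ b)                             ≡⟨ spread W n k (b zero) (∑ b) ⟩
    n * (W * b zero) + k * (W * ∑ b)                       ≡⟨ cong₂ (λ u v → n * u + k * v) (sym (total zero)) (sym (trans ∑-total (∑-*ˡ W b))) ⟩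
    n * ∑ (λ σ → # (S σ zero)) + k * ∑ (λ σ → ∑ λ i → # (S σ i))
      ≡⟨ sym (trans (∑-+ (λ σ → n * # (S σ zero)) (λ σ → k * ∑ λ i → # (S σ i)))
                    (cong₂ _+_ (∑-*ˡ n (λ σ → # (S σ zero))) (∑-*ˡ k (λ σ → ∑ λ i → # (S σ i))))) ⟩
    ∑ (λ σ → n * # (S σ zero) + k * ∑ λ i → # (S σ i))     ≤⟨ ∑-mono circle ⟩
    ∑ (λ σ → s * k * n + suc s * k * # (S σ zero))
      ≡⟨ trans (∑-+ {n !} (λ _ → s * k * n) (λ σ → suc s * k * # (S σ zero)))
               (cong₂ _+_ (∑-const (n !) _) (∑-*ˡ (suc s * k) (λ σ → # (S σ zero)))) ⟩
    n ! * (s * k * n) + suc s * k * ∑ (λ σ → # (S σ zero))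
      ≡⟨ cong₂ (λ u v → u * (s * k * n) + suc s * k * v) (sym (nCk*k!*[n∸k]! k≤n)) (total zero) ⟩
    (n C k) * (k ! * (n ∸ k) !) * (s * k * n) + suc s * k * (W * b zero)
      ≡⟨ collect n (k ! * (n ∸ k) !) (n C k) s k (b zero) ⟩
    W * (s * k * (n C k) + suc s * k * b zero)             ∎)
  where
  open ≤-Reasoning
  b : Vector ℕ (suc s)
  b i = card (ℬ i)

  S : Fin (n !) → Fin (suc s) → Fin n → Bool
  S σ i x = ℬ i (act n σ (arc k x))

  W = n * (k ! * (n ∸ k) !)

  k≤n : k ≤ n
  k≤n = ≤-trans (m≤m+n k (s * k)) [1+s]k≤n

  W≢0 : NonZero W
  W≢0 = m*n≢0 n _ {{>-nonZero (<-≤-trans (>-nonZero⁻¹ k) k≤n)}} {{k !* (n ∸ k) !≢0}}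

  total : ∀ i → ∑ (λ σ → # (S σ i)) ≡ W * b i
  total i = ∑-arcs k≤n (ℬ i) (uniform i)

  ∑-total : ∑ (λ σ → ∑ λ i → # (S σ i)) ≡ ∑ (λ i → W * b i)
  ∑-total = trans (∑-swap (λ σ i → # (S σ i))) (∑-cong total)

  circle : ∀ σ → n * # (S σ zero) + k * ∑ (λ i → # (S σ i)) ≤ s * k * n + suc s * k * # (S σ zero)
  circle σ = on-cycle (n ∸ suc s * k) (m∸n+n≡m [1+s]k≤n) (S σ)
    (λ i j i≤j x → chain-monotone ℬ chain i j i≤j (act n σ (arc k x)))
    (overlapping⇒¬rainbow ℬ overlapping σ)
    where
    on-cycle : ∀ r {n} → r + suc s * k ≡ n → (S : Fin (suc s) → Fin n → Bool) →
      (∀ i j → i Fin.≤ j → ∀ x → T (S i x) → T (S j x)) → ¬ Rainbow k S →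
      n * # (S zero) + k * ∑ (λ i → # (S i)) ≤ s * k * n + suc s * k * # (S zero)
    on-cycle r refl = cyclic-bound k r

  spread : ∀ w n k a b → w * (n * a + k * b) ≡ n * (w * a) + k * (w * b)
  spread = solve-∀
  collect : ∀ n w c s k a → c * w * (s * k * n) + (1 + s) * k * (n * w * a) ≡ n * w * (s * k * c + (1 + s) * k * a)
  collect = solve-∀

-- From the averaged inequality to the two bounds.

-- Here a = |ℬ_0|, t = |ℬ_1| + ⋯ + |ℬ_s|, c = C(n,k) and c′ = C(n-1,k-1). The case split compares p
-- with n/k - s, the coefficient of a in the averaged inequality.
weighted-bound : ∀ n k s p .{{_ : NonZero k}} {a t c c′} →
  n * a + k * t ≤ s * k * c + s * k * a → s * a ≤ t → k * c ≡ n * c′ → .{{_ : NonZero n}} →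
  p * a + t ≤ (s * c) ⊔ ((p + s) * s * c′)
weighted-bound n k s p {a} {t} {c} {c′} bound sa≤t kc≡nc′ with ≤-total ((p + s) * k) n
... | inj₁ [p+s]k≤n = ≤-trans (*-cancelˡ-≤ k (+-cancelʳ-≤ (s * k * a) _ _ (begin
  k * (p * a + t) + s * k * a          ≡⟨ e₁ k p a t s ⟩
  (p + s) * k * a + k * t              ≤⟨ +-monoˡ-≤ (k * t) (*-monoˡ-≤ a [p+s]k≤n) ⟩
  n * a + k * t                        ≤⟨ bound ⟩
  s * k * c + s * k * a                ≡⟨ cong (_+ s * k * a) (e₂ s k c) ⟩
  k * (s * c) + s * k * a              ∎))) (m≤m⊔n (s * c) _)
  where
  open ≤-Reasoning
  e₁ : ∀ k p a t s → k * (p * a + t) + s * k * a ≡ (p + s) * k * a + k * t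
  e₁ = solve-∀
  e₂ : ∀ s k c → s * k * c ≡ k * (s * c)
  e₂ = solve-∀
-- After multiplication by k, the weight of a exceeds that in the averaged inequality by d = (p + s)
-- k - n; this excess is paid for by a ≤ s c′.
... | inj₂ n≤[p+s]k with d , n+d≡[p+s]k ← m≤n⇒∃[o]m+o≡n n≤[p+s]k =
  ≤-trans (*-cancelˡ-≤ k (+-cancelʳ-≤ (s * k * a) _ _ (begin
    k * (p * a + t) + s * k * a                    ≡⟨ e₁ k p a t s ⟩
    (p + s) * k * a + k * t                        ≡⟨ cong (λ m → m * a + k * t) (sym n+d≡[p+s]k) ⟩
    (n + d) * a + k * t                            ≡⟨ e₂ n d a (k * t) ⟩
    (n * a + k * t) + d * a                        ≤⟨ +-mono-≤ bound (*-monoʳ-≤ d a≤sc′) ⟩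
    (s * k * c + s * k * a) + d * (s * c′)         ≡⟨ e₃ s k c a (d * (s * c′)) ⟩
    (s * (k * c) + d * (s * c′)) + s * k * a       ≡⟨ cong (λ m → s * m + d * (s * c′) + s * k * a) kc≡nc′ ⟩
    (s * (n * c′) + d * (s * c′)) + s * k * a      ≡⟨ cong (_+ s * k * a) (e₄ s n c′ d) ⟩
    (n + d) * (s * c′) + s * k * a                 ≡⟨ cong (λ m → m * (s * c′) + s * k * a) n+d≡[p+s]k ⟩
    (p + s) * k * (s * c′) + s * k * a             ≡⟨ cong (_+ s * k * a) (e₅ (p + s) k s c′) ⟩
    k * ((p + s) * s * c′) + s * k * a             ∎)))
  (m≤n⊔m (s * c) _)
  where
  open ≤-Reasoning
  e₁ : ∀ k p a t s → k * (p * a + t) + s * k * a ≡ (p + s) * k * a + k * t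
  e₁ = solve-∀
  e₂ : ∀ n d a u → (n + d) * a + u ≡ (n * a + u) + d * a
  e₂ = solve-∀
  e₃ : ∀ s k c a u → (s * k * c + s * k * a) + u ≡ (s * (k * c) + u) + s * k * a
  e₃ = solve-∀
  e₄ : ∀ s n c d → s * (n * c) + d * (s * c) ≡ (n + d) * (s * c)
  e₄ = solve-∀
  e₅ : ∀ q k s c → q * k * (s * c) ≡ k * (q * s * c)
  e₅ = solve-∀
  e₆ : ∀ s k c → s * k * c ≡ s * (k * c)
  e₆ = solve-∀
  e₇ : ∀ s n c → s * (n * c) ≡ n * (s * c)
  e₇ = solve-∀
  e₈ : ∀ s k a → s * k * a ≡ k * (s * a)
  e₈ = solve-∀

  -- Since s a ≤ t, the term s k a on the right of the bound is at most the k t on the left; what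
  -- remains is n a ≤ s k c = n s c′.
  a≤sc′ : a ≤ s * c′
  a≤sc′ = *-cancelˡ-≤ n (+-cancelʳ-≤ (k * t) _ _ (begin
    n * a + k * t                  ≤⟨ bound ⟩
    s * k * c + s * k * a          ≤⟨ +-monoʳ-≤ (s * k * c) (≤-trans (≤-reflexive (e₈ s k a)) (*-monoʳ-≤ k sa≤t)) ⟩
    s * k * c + k * t              ≡⟨ cong (_+ k * t) (trans (e₆ s k c) (trans (cong (s *_) kc≡nc′) (e₇ s n c′))) ⟩
    n * (s * c′) + k * t           ∎))
attained-≤ : ∀ n k s p .{{_ : NonZero n}} .{{_ : NonZero k}} → suc s * k ≤ n → ∀ {v} →
  Attained (p ∷ replicate s 1) n k v → v ≤ (s * (n C k)) ⊔ ((p + s) * s * ((n ∸ 1) C (k ∸ 1)))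
attained-≤ n@(suc n′) k@(suc k′) s p [1+s]k≤n {v} (ℬ , admissible@(chain , _) , weight≡v) = begin
  v                                                          ≡⟨ sym weight≡v ⟩
  p * b zero + ∑ (λ i → 1 * b (suc i))                       ≡⟨ cong (p * b zero +_) (trans (∑-*ˡ 1 (b ∘ suc)) (*-identityˡ _)) ⟩
  p * b zero + ∑ (b ∘ suc)                                   ≤⟨ weighted-bound n k s p bound sb₀≤ (absorption k′≤n′) ⟩
  (s * (n C k)) ⊔ ((p + s) * s * (n′ C k′))                  ∎
  where
  open ≤-Reasoning
  b : Vector ℕ (suc s)
  b i = card (ℬ i)

  k′≤n′ : k′ ≤ n′
  k′≤n′ = ≤-pred (≤-trans (m≤m+n k (s * k)) [1+s]k≤n)

  sb₀≤ : s * b zero ≤ ∑ (b ∘ suc)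
  sb₀≤ = begin
    s * b zero              ≡⟨ sym (∑-const s (b zero)) ⟩
    ∑ {s} (λ _ → b zero)    ≤⟨ ∑-mono (λ i → card-mono (chain-monotone ℬ chain zero (suc i) z≤n)) ⟩
    ∑ (b ∘ suc)             ∎

  bound : n * b zero + k * ∑ (b ∘ suc) ≤ s * k * (n C k) + s * k * b zero
  bound = +-cancelʳ-≤ (k * b zero) _ _ (begin
    n * b zero + k * ∑ (b ∘ suc) + k * b zero           ≡⟨ e₁ n k (b zero) (∑ (b ∘ suc)) ⟩
    n * b zero + k * (b zero + ∑ (b ∘ suc))             ≤⟨ averaged-bound n k ℬ [1+s]k≤n admissible ⟩
    s * k * (n C k) + suc s * k * b zero                ≡⟨ e₂ s k (n C k) (b zero) ⟩
    s * k * (n C k) + s * k * b zero + k * b zero       ∎)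
    where
    e₁ : ∀ n k a t → n * a + k * t + k * a ≡ n * a + k * (a + t)
    e₁ = solve-∀
    e₂ : ∀ s k c a → s * k * c + (1 + s) * k * a ≡ s * k * c + s * k * a + k * a
    e₂ = solve-∀

theorem1p3 : (n k s p : ℕ) .{{_ : NonZero n}} .{{_ : NonZero k}} .{{_ : NonZero s}} .{{_ : NonZero p}} →
    (s + 1) * k ≤ n →
    f (p ∷ replicate s 1) n k ≤ (s * (n C k)) ⊔ ((p + s) * s * ((n ∸ 1) C (k ∸ 1)))
theorem1p3 n k s p [s+1]k≤n =
  attained-≤ n k s p (subst (λ m → m * k ≤ n) (+-comm s 1) [s+1]k≤n)
    (proj₁ (f-isMaximum (p ∷ replicate s 1) n k))
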